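{- Let $\mathcal{C}$ be a monadically NIP graph class and let $\varphi(\bar x)$ be a first-order formula. Then there exist a first-order formula $\hat\varphi(\bar x)$ and $c,k\in\mathbb{N}$ such that for all $G\in\mathcal{C}$ and $A\subseteq V(G)$ there exists a monadic lift $\hat G$ of an induced subgraph of $G$ such that \[|\hat G|\le c\,|A|^{k}\quad\text{and}\quad \varphi(G)[A]=\hat\varphi(\hat G)[A].\]
   Context: Graphs are finite, simple, undirected and vertex-colored: a graph has a vertex set, an edge set, and finitely many color classes (unary predicates, not necessarily disjoint); they are viewed as structures with one binary edge relation and one unary relation per color class. A graph class is a set of graphs using colors from one fixed finite palette; formulas $\varphi$ are over the signature of the class. $|G|$ is the number of vertices of $G$. A monadic lift of a graph $G$ is a graph obtained from $G$ by adding a number of additional color classes (the formula $\hat\varphi$ may use these additional colors). For a formula $\varphi(\bar x)$ and a structure $G$, $\varphi(G)=\{\bar v\in V(G)^{\bar x} : G\models\varphi(\bar v)\}$; for a set $\Omega$ of tuples and a set $A$, $\Omega[A]$ is the set of those tuples of $\Omega$ all of whose elements lie in $A$. Interpretations and transductions. Signatures consist of unary and binary relation symbols. An interpretation $\mathsf{I}$ from $\Sigma$-structures to $\Gamma$-structures consists of a formula $\delta(x)$ and a formula $\varphi_R(x_1,\dots,x_m)$ for each $R\in\Gamma$ of arity $m$; it maps $\mathbf{A}$ to the structure with universe $\{v:\mathbf{A}\models\delta(v)\}$ in which $R$ consists of the tuples of elements of this universe satisfying $\varphi_R$ in $\mathbf{A}$. For $k\in\mathbb{N}$, $k\times\mathbf{A}$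 is the disjoint union of $k$ copies of $\mathbf{A}$ with an additional symmetric binary relation $M$ containing all pairs $(v,v')$ where $v,v'$ originate from the same element of $\mathbf{A}$. A transduction $\mathsf{T}$ from $\Sigma$ to $\Gamma$ consists of $k\in\mathbb{N}$, unary symbols $U_1,\dots,U_m$, and an interpretation $\mathsf{I}$ from $\Sigma\cup\{M,U_1,\dots,U_m\}$ to $\Gamma$; $\mathsf{T}(\mathbf{A})$ is the set of all $\mathsf{I}(\widehat{\mathbf{A}})$ where $\widehat{\mathbf{A}}$ is an expansion of $k\times\mathbf{A}$ by arbitrary interpretations of $U_1,\dots,U_m$. $\mathsf{T}(\mathcal{C})=\bigcup_{\mathbf{A}\in\mathcal{C}}\mathsf{T}(\mathbf{A})$. A graph class $\mathcal{C}$ is monadically NIP if for every transduction $\mathsf{T}$, $\mathsf{T}(\mathcal{C})$ is not the class of all graphs. -}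

module Defs where

open import Data.Bool using (Bool; true; false; T)
open import Data.Empty using (⊥)
open import Data.Fin using (Fin; zero; suc)
open import Data.Fin.Subset using (Subset; inside; outside; ∣_∣)
import Data.Fin.Subset as Subset
open import Data.Nat using (ℕ; suc; _+_)
open import Data.Product using (Σ-syntax; ∃-syntax; _×_; _,_; proj₁; proj₂)
open import Data.Refinement using (Refinement; value)
open import Data.Sum using (_⊎_; inj₁; inj₂; [_,_]′)
open import Data.Unit using (⊤; tt)
open import Data.Vec using (Vec; []; _∷_; lookup; map)
open import Data.Vec.Functional using (Vector; _++_)
open import Data.Vec.Relation.Unary.All using (All)
open import Function using (_∘_; _on_; _↔_; _⇔_; Inverse)
open import Level using (Level; 0ℓ) renaming (suc to lsuc; _⊔_ to _⊔ˡ_)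
open import Relation.Binary using (Rel)
open import Relation.Binary.PropositionalEquality using (_≡_)
open import Relation.Nullary using (¬_)
open import Relation.Unary using (Pred; _≐_)

record Signature : Set₁ where
  field
    Unary  : Set
    Binary : Set

open Signature public

record Structure (𝒮 : Signature) : Set₁ where
  field
    Carrier : Set
    unary   : Unary 𝒮 → Pred Carrier 0ℓ
    binary  : Binary 𝒮 → Rel Carrier 0ℓ

open Structure public

-- Formula 𝒮 n: formulas with free variables among x₀, …, xₙ₋₁.  Variables
-- are de Bruijn indices: a quantifier binds variable zero of its body.

data Formula (𝒮 : Signature) (n : ℕ) : Set where
  falsum      : Formula 𝒮 n
  equal       : (x y : Fin n) → Formula 𝒮 n
  atom₁       : Unary 𝒮 → (x : Fin n) → Formula 𝒮 n
  atom₂       : Binary 𝒮 → (x y : Fin n) → Formula 𝒮 n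
  neg         : Formula 𝒮 n → Formula 𝒮 n
  and or      : (φ ψ : Formula 𝒮 n) → Formula 𝒮 n
  exists all′ : Formula 𝒮 (suc n) → Formula 𝒮 n

infix 4 _⊨_[_]

_⊨_[_] : ∀ {𝒮 n} (A : Structure 𝒮) → Formula 𝒮 n → Vec (Carrier A) n → Set
A ⊨ falsum      [ ρ ] = ⊥
A ⊨ equal x y   [ ρ ] = lookup ρ x ≡ lookup ρ y
A ⊨ atom₁ u x   [ ρ ] = unary A u (lookup ρ x)
A ⊨ atom₂ r x y [ ρ ] = binary A r (lookup ρ x) (lookup ρ y)
A ⊨ neg φ       [ ρ ] = ¬ (A ⊨ φ [ ρ ])
A ⊨ and φ ψ     [ ρ ] = (A ⊨ φ [ ρ ]) × (A ⊨ ψ [ ρ ])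
A ⊨ or φ ψ      [ ρ ] = (A ⊨ φ [ ρ ]) ⊎ (A ⊨ ψ [ ρ ])
A ⊨ exists φ    [ ρ ] = Σ[ a ∈ Carrier A ] A ⊨ φ [ a ∷ ρ ]
A ⊨ all′ φ      [ ρ ] = (a : Carrier A) → A ⊨ φ [ a ∷ ρ ]

record _≅_ {𝒮 : Signature} (A B : Structure 𝒮) : Set where
  field
    bijection : Carrier A ↔ Carrier B

  open Inverse bijection public using (to; from)

  field
    unary-⇔  : ∀ u a → unary A u a ⇔ unary B u (to a)
    binary-⇔ : ∀ r a b → binary A r a b ⇔ binary B r (to a) (to b)

record Interpretation (𝒮 𝒯 : Signature) : Set where
  field
    domain : Formula 𝒮 1
    rel₁   : Unary 𝒯 → Formula 𝒮 1
    rel₂   : Binary 𝒯 → Formula 𝒮 2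

interpret : ∀ {𝒮 𝒯} → Interpretation 𝒮 𝒯 → Structure 𝒮 → Structure 𝒯
interpret I A = record
  { Carrier = Refinement (Carrier A) (λ v → A ⊨ domain [ v ∷ [] ])
  ; unary   = λ u v → A ⊨ rel₁ u [ value v ∷ [] ]
  ; binary  = λ r v w → A ⊨ rel₂ r [ value v ∷ value w ∷ [] ]
  }
  where open Interpretation I

withM : Signature → Signature
withM 𝒮 = record { Unary = Unary 𝒮 ; Binary = Binary 𝒮 ⊎ ⊤ }

withUnary : ℕ → Signature → Signature
withUnary m 𝒮 = record { Unary = Unary 𝒮 ⊎ Fin m ; Binary = Binary 𝒮 }

-- The element (i , a) is the i-th copy of a; the symbol inj₂ tt is M.

copies : ∀ {𝒮} → ℕ → Structure 𝒮 → Structure (withM 𝒮)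
copies k A = record
  { Carrier = Fin k × Carrier A
  ; unary   = λ u x → unary A u (proj₂ x)
  ; binary  = [ (λ r x y → proj₁ x ≡ proj₁ y × binary A r (proj₂ x) (proj₂ y))
              , (λ _ x y → proj₂ x ≡ proj₂ y)
              ]′
  }

expand : ∀ {𝒮 m} (A : Structure 𝒮) → (Fin m → Pred (Carrier A) 0ℓ) →
         Structure (withUnary m 𝒮)
expand A U = record
  { Carrier = Carrier A
  ; unary   = [ unary A , U ]′
  ; binary  = binary A
  }

record Transduction (𝒮 𝒯 : Signature) : Set where
  field
    #copies        : ℕ
    #unary         : ℕ
    interpretation : Interpretation (withUnary #unary (withM 𝒮)) 𝒯

-- B ∈ T(A), up to isomorphism.

_∈⟨_⟩_ : ∀ {𝒮 𝒯} → Structure 𝒯 → Transduction 𝒮 𝒯 → Structure 𝒮 → Set₁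
B ∈⟨ 𝖳 ⟩ A =
  Σ[ U ∈ (Fin #unary → Pred (Carrier (copies #copies A)) 0ℓ) ]
    B ≅ interpret interpretation (expand (copies #copies A) U)
  where open Transduction 𝖳

-- Finite simple graphs with p (not necessarily disjoint) color classes.
-- Vertex sets are Fin n, so every finite graph is represented up to
-- isomorphism.

record Graph (p : ℕ) : Set where
  field
    order      : ℕ
    adj        : Fin order → Fin order → Bool
    adj-sym    : ∀ u v → adj u v ≡ adj v u
    adj-irrefl : ∀ v → adj v v ≡ false
    color      : Vector (Fin order → Bool) p

open Graph public

Vertex : ∀ {p} → Graph p → Set
Vertex G = Fin (order G)

graphSignature : ℕ → Signature
graphSignature p = record { Unary = Fin p ; Binary = ⊤ }

⟦_⟧ : ∀ {p} → Graph p → Structure (graphSignature p)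
⟦ G ⟧ = record
  { Carrier = Vertex G
  ; unary   = λ i v → T (color G i v)
  ; binary  = λ _ u v → T (adj G u v)
  }

enum : ∀ {n} (S : Subset n) → Fin ∣ S ∣ → Fin n
enum (inside  ∷ S) zero    = zero
enum (inside  ∷ S) (suc i) = suc (enum S i)
enum (outside ∷ S) i       = suc (enum S i)

-- The i-th vertex of the induced subgraph is the i-th element of S, enum S i.

induced : ∀ {p} (G : Graph p) → Subset (order G) → Graph p
induced G S = record
  { order      = ∣ S ∣
  ; adj        = adj G on enum S
  ; adj-sym    = λ u v → adj-sym G (enum S u) (enum S v)
  ; adj-irrefl = λ v → adj-irrefl G (enum S v)
  ; color      = λ i → color G i ∘ enum S
  }

monadicLift : ∀ {p q} (G : Graph p) → Vector (Vertex G → Bool) q → Graph (p + q)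
monadicLift G new = record
  { order      = order G
  ; adj        = adj G
  ; adj-sym    = adj-sym G
  ; adj-irrefl = adj-irrefl G
  ; color      = color G ++ new
  }

GraphClass : ℕ → (ℓ : Level) → Set (lsuc ℓ)
GraphClass p ℓ = Pred (Graph p) ℓ

_⟨_⟩ : ∀ {p ℓ 𝒯} → Transduction (graphSignature p) 𝒯 → GraphClass p ℓ →
       Pred (Structure 𝒯) (lsuc 0ℓ ⊔ˡ ℓ)
(𝖳 ⟨ 𝒞 ⟩) B = ∃[ G ] 𝒞 G × B ∈⟨ 𝖳 ⟩ ⟦ G ⟧

-- Uncolored targets suffice: a transduction onto all colored graphs yields one
-- onto all uncolored graphs by forgetting the colors, and conversely colors can
-- be produced with additional unary predicates.

AllGraphs : Pred (Structure (graphSignature 0)) 0ℓ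
AllGraphs B = Σ[ H ∈ Graph 0 ] B ≅ ⟦ H ⟧

MonadicallyNIP : ∀ {p ℓ} → GraphClass p ℓ → Set (lsuc 0ℓ ⊔ˡ ℓ)
MonadicallyNIP {p} 𝒞 =
  (𝖳 : Transduction (graphSignature p) (graphSignature 0)) → ¬ (𝖳 ⟨ 𝒞 ⟩ ≐ AllGraphs)

solutions : ∀ {p n} → Formula (graphSignature p) n → (G : Graph p) →
            Pred (Vec (Vertex G) n) 0ℓ
solutions φ G v = ⟦ G ⟧ ⊨ φ [ v ]

_↾_ : ∀ {m n} → Pred (Vec (Fin m) n) 0ℓ → Subset m → Pred (Vec (Fin m) n) 0ℓ
(Ω ↾ A) v = Ω v × All (Subset._∈ A) v

-- Tuples of vertices of a (lift of an) induced subgraph on S, viewed as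
-- tuples of vertices of the ambient graph.

image : ∀ {m n} (S : Subset m) → Pred (Vec (Fin ∣ S ∣) n) 0ℓ → Pred (Vec (Fin m) n) 0ℓ
image S Ω v = ∃[ w ] map (enum S) w ≡ v × Ω w

{-# OPTIONS --safe #-}

-- Call the ψ(y, x̄)-type of a vertex y over a vertex set C the set of tuples x̄
-- of C with ψ(y, x̄).  If only polynomially many such types are realised, then
-- C extends to a set D of polynomial size realising all of them, and a
-- quantifier over y applied to ψ(y, x̄) with x̄ in C may be restricted to D.
-- Iterating along the quantifier rank gives a chain A = C_r ⊆ … ⊆ C₀ = S;
-- colours for the C_j make the restricted formula expressible on G[S].
--
-- The number of types is bounded by induction on the length of x̄ = (x, x̄′).
-- For fixed x, naming x by a colour leaves polynomially many classes of y.
-- A Sauer–Shelah argument in the style of Natarajan then bounds the types over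
-- all x, unless arbitrarily many points x are shattered, that is, two classes
-- per point are combined in all possible ways.  In that case, naming one y₀, the
-- formula "y and y₀ lie in the same class at x" shatters arbitrarily many
-- single vertices, and marking vertices y that pick out pairs of them
-- transduces every graph.
module Submission where

open import Defs
open import Axiom.ExcludedMiddle using (ExcludedMiddle)
open import Data.Bool using (Bool; true; false; T; if_then_else_)
open import Data.Empty using (⊥-elim)
open import Data.Fin using (Fin; zero; suc; lift; toℕ; fromℕ<; _↑ˡ_; _↑ʳ_)
open import Data.Fin.Properties using (any?; suc-injective; toℕ-fromℕ<) renaming (_≟_ to _≟ᶠ_)
open import Data.Fin.Subset using (Subset; ∣_∣; inside; outside; ⁅_⁆; _∪_)
import Data.Fin.Subset as Subset
open import Data.Fin.Subset.Properties using (_∈?_; p⊆p∪q; q⊆p∪q; ∣⁅x⁆∣≡1; x∈⁅x⁆; drop-there; ∣⊥∣≡0; ∉⊥)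
import Data.Irrelevant as Irrelevant
open import Data.List as List using (List; []; _∷_; length; cartesianProduct)
open import Data.List.Properties using (length-++; length-map; length-tabulate)
open import Data.List.Membership.Propositional using (find; lose) renaming (_∈_ to _∈ˡ_)
open import Data.List.Membership.Propositional.Properties using (∈-cartesianProduct⁺; ∈-tabulate⁺)
open import Data.List.Relation.Unary.All as AllL using (_∷_; []) renaming (All to Allˡ)
open import Data.List.Relation.Unary.Any as Any using (Any; here; there)
open import Data.List.Relation.Unary.Any.Properties using (++⁺ˡ; ++⁺ʳ)
open import Data.Nat using (ℕ; zero; suc; _+_; _*_; _^_; _≤_; _<_; _⊔_; z≤n; s≤s; _≤′_; ≤′-reflexive; ≤′-step)
open import Data.Nat.Properties
  using (≤-refl; ≤-reflexive; ≤-trans; module ≤-Reasoning; *-identityˡ; *-identityʳ;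
         +-mono-≤; *-mono-≤; *-monoˡ-≤; *-monoʳ-≤; ^-monoˡ-≤; ^-monoʳ-≤; m≤m+n; m≤n+m;
         *-distribʳ-+; [m*n]*[o*p]≡[m*o]*[n*p]; ^-distribˡ-+-*; +-comm; m^n>0;
         m⊔n≤o⇒m≤o; m⊔n≤o⇒n≤o; m≤m⊔n; m≤n⊔m; +-monoʳ-≤; n≤1+n; +-suc; <⇒≤; ≤⇒≤′)
open import Data.Product using (Σ-syntax; ∃-syntax; _×_; _,_; proj₁; proj₂)
open import Data.Refinement using (value; value-injective) renaming (_,_ to _▹_)
open import Data.Sum using (_⊎_; inj₁; inj₂; [_,_]′)
open import Data.Unit using (⊤; tt)
open import Data.Vec using (Vec; []; _∷_; lookup; map; _++_; here; there)
open import Data.Vec.Properties using (lookup-++ˡ; lookup-++ʳ; lookup-map)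
import Data.Vec.Functional as Vector
open import Data.Vec.Functional using (Vector)
import Data.Vec.Functional.Properties as Vector
open import Data.Vec.Relation.Unary.All as All using (All; []; _∷_)
open import Function using (_∘_; id; _↔_; _⇔_; mk⇔; mk↔ₛ′; Equivalence; Inverse)
open import Function.Properties.Inverse using (↔-refl; ↔-trans)
import Function.Properties.Equivalence as ⇔
open import Level using (0ℓ) renaming (suc to lsuc; _⊔_ to _⊔ˡ_)
open import Relation.Binary.PropositionalEquality
open import Relation.Nullary using (¬_; Dec; yes; no; does; recompute)
open import Relation.Nullary.Decidable using (_⊎-dec_; does-⇔; dec-false; decidable-stable)
open import Relation.Unary using (Pred; _≐_)

open Equivalence using (to; from)

-- Formulas

relabel : ∀ {𝒮 𝒯 m n} → (Unary 𝒮 → Unary 𝒯) → (Binary 𝒮 → Binary 𝒯) →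
          (Fin m → Fin n) → Formula 𝒮 m → Formula 𝒯 n
relabel f g σ falsum        = falsum
relabel f g σ (equal x y)   = equal (σ x) (σ y)
relabel f g σ (atom₁ u x)   = atom₁ (f u) (σ x)
relabel f g σ (atom₂ r x y) = atom₂ (g r) (σ x) (σ y)
relabel f g σ (neg φ)       = neg (relabel f g σ φ)
relabel f g σ (and φ ψ)     = and (relabel f g σ φ) (relabel f g σ ψ)
relabel f g σ (or φ ψ)      = or (relabel f g σ φ) (relabel f g σ ψ)
relabel f g σ (exists φ)    = exists (relabel f g (lift 1 σ) φ)
relabel f g σ (all′ φ)      = all′ (relabel f g (lift 1 σ) φ)

reduct : ∀ {𝒮 𝒯} → (Unary 𝒮 → Unary 𝒯) → (Binary 𝒮 → Binary 𝒯) →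
         Structure 𝒯 → Structure 𝒮
reduct f g A = record
  { Carrier = Carrier A
  ; unary   = unary A ∘ f
  ; binary  = binary A ∘ g
  }

≅-refl : ∀ {𝒮} {A : Structure 𝒮} → A ≅ A
≅-refl = record
  { bijection = ↔-refl
  ; unary-⇔   = λ _ _ → ⇔.refl
  ; binary-⇔  = λ _ _ _ → ⇔.refl
  }

≅-trans : ∀ {𝒮} {A B C : Structure 𝒮} → A ≅ B → B ≅ C → A ≅ C
≅-trans I J = record
  { bijection = ↔-trans I.bijection J.bijection
  ; unary-⇔   = λ u a → ⇔.trans (I.unary-⇔ u a) (J.unary-⇔ u (I.to a))
  ; binary-⇔  = λ r a b → ⇔.trans (I.binary-⇔ r a b) (J.binary-⇔ r (I.to a) (I.to b))
  }
  where
  module I = _≅_ I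
  module J = _≅_ J

module _ {𝒮 𝒯} (f : Unary 𝒮 → Unary 𝒯) (g : Binary 𝒮 → Binary 𝒯)
         {A : Structure 𝒮} {B : Structure 𝒯} (I : reduct f g B ≅ A) where
  private
    module I = _≅_ I
    module π = Inverse I.bijection

    injective : ∀ {b c} → I.to b ≡ I.to c → b ≡ c
    injective {b} {c} e =
      trans (sym (π.strictlyInverseʳ b)) (trans (cong I.from e) (π.strictlyInverseʳ c))

    extend : ∀ {m n} (σ : Fin m → Fin n) {ρ : Vec (Carrier A) m} {τ : Vec (Carrier B) n} {a b} →
             I.to b ≡ a → (∀ i → I.to (lookup τ (σ i)) ≡ lookup ρ i) →
             ∀ i → I.to (lookup (b ∷ τ) (lift 1 σ i)) ≡ lookup (a ∷ ρ) i
    extend σ b≡a h zero    = b≡a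
    extend σ b≡a h (suc i) = h i

  -- Stated up to an isomorphism with a reduct, so that one induction covers renaming variables,
  -- adding colours and passing to a single copy with `M`.
  ⊨-relabel : ∀ {m n} (σ : Fin m → Fin n) φ {ρ : Vec (Carrier A) m} {τ : Vec (Carrier B) n} →
              (∀ i → I.to (lookup τ (σ i)) ≡ lookup ρ i) →
              (B ⊨ relabel f g σ φ [ τ ]) ⇔ (A ⊨ φ [ ρ ])
  ⊨-relabel σ falsum h = ⇔.refl
  ⊨-relabel σ (equal x y) h = mk⇔
    (λ e → trans (sym (h x)) (trans (cong I.to e) (h y)))
    (λ e → injective (trans (h x) (trans e (sym (h y)))))
  ⊨-relabel σ (atom₁ u x) h rewrite sym (h x) = I.unary-⇔ u _
  ⊨-relabel σ (atom₂ r x y) h rewrite sym (h x) | sym (h y) = I.binary-⇔ r _ _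
  ⊨-relabel σ (neg φ) h = mk⇔ (_∘ from (⊨-relabel σ φ h)) (_∘ to (⊨-relabel σ φ h))
  ⊨-relabel σ (and φ ψ) h = mk⇔
    (λ (p , q) → to (⊨-relabel σ φ h) p , to (⊨-relabel σ ψ h) q)
    (λ (p , q) → from (⊨-relabel σ φ h) p , from (⊨-relabel σ ψ h) q)
  ⊨-relabel σ (or φ ψ) h = mk⇔
    [ inj₁ ∘ to (⊨-relabel σ φ h) , inj₂ ∘ to (⊨-relabel σ ψ h) ]′
    [ inj₁ ∘ from (⊨-relabel σ φ h) , inj₂ ∘ from (⊨-relabel σ ψ h) ]′
  ⊨-relabel σ (exists φ) h = mk⇔
    (λ (b , p) → I.to b , to (⊨-relabel (lift 1 σ) φ (extend σ refl h)) p)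
    (λ (a , p) → I.from a , from (⊨-relabel (lift 1 σ) φ (extend σ (π.strictlyInverseˡ a) h)) p)
  ⊨-relabel σ (all′ φ) h = mk⇔
    (λ p a → to (⊨-relabel (lift 1 σ) φ (extend σ (π.strictlyInverseˡ a) h)) (p (I.from a)))
    (λ p b → from (⊨-relabel (lift 1 σ) φ (extend σ refl h)) (p (I.to b)))

imp iff : ∀ {𝒮 n} → Formula 𝒮 n → Formula 𝒮 n → Formula 𝒮 n
imp φ ψ = or (neg φ) ψ
iff φ ψ = and (imp φ ψ) (imp ψ φ)

-- The head of the block is bound innermost, so that the environment has the form `xs ++ ρ`.
allIn : ∀ {𝒮 n} → Unary 𝒮 → ∀ k → Formula 𝒮 (k + n) → Formula 𝒮 n
allIn u zero    φ = φ
allIn u (suc k) φ = allIn u k (all′ (imp (atom₁ u zero) φ))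

module _ (lem : ExcludedMiddle 0ℓ) {𝒮} (A : Structure 𝒮) where

  ⊨-imp : ∀ {n} (φ ψ : Formula 𝒮 n) {ρ} →
          (A ⊨ imp φ ψ [ ρ ]) ⇔ (A ⊨ φ [ ρ ] → A ⊨ ψ [ ρ ])
  ⊨-imp φ ψ {ρ} = mk⇔
    (λ { (inj₁ ¬p) p → ⊥-elim (¬p p) ; (inj₂ q) _ → q })
    λ f → case-em f lem
    where
    case-em : (A ⊨ φ [ ρ ] → A ⊨ ψ [ ρ ]) → Dec (A ⊨ φ [ ρ ]) → A ⊨ imp φ ψ [ ρ ]
    case-em f (yes p) = inj₂ (f p)
    case-em f (no ¬p) = inj₁ ¬p

  ⊨-iff : ∀ {n} (φ ψ : Formula 𝒮 n) {ρ} →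
          (A ⊨ iff φ ψ [ ρ ]) ⇔ ((A ⊨ φ [ ρ ]) ⇔ (A ⊨ ψ [ ρ ]))
  ⊨-iff φ ψ = mk⇔
    (λ (p , q) → mk⇔ (to (⊨-imp φ ψ) p) (to (⊨-imp ψ φ) q))
    (λ e → from (⊨-imp φ ψ) (to e) , from (⊨-imp ψ φ) (from e))

  ⊨-allIn : ∀ {n} u k (φ : Formula 𝒮 (k + n)) {ρ} →
            (A ⊨ allIn u k φ [ ρ ]) ⇔
            (∀ (xs : Vec (Carrier A) k) → All (unary A u) xs → A ⊨ φ [ xs ++ ρ ])
  ⊨-allIn u zero    φ = mk⇔ (λ { p [] [] → p }) (λ p → p [] [])
  ⊨-allIn u (suc k) φ = mk⇔
    (λ { p (x ∷ xs) (ux ∷ uxs) →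
         to (⊨-imp (atom₁ u zero) φ) (to (⊨-allIn u k (all′ (imp (atom₁ u zero) φ))) p xs uxs x) ux })
    (λ p → from (⊨-allIn u k (all′ (imp (atom₁ u zero) φ)))
      λ xs uxs x → from (⊨-imp (atom₁ u zero) φ) λ ux → p (x ∷ xs) (ux ∷ uxs))

-- Polynomials

infixl 6 _⊕_
infixl 7 _⊗_

-- Bounds are kept as syntax, so that they add, multiply and compose freely; natural coefficients
-- make them monotone. Only the final bound is turned into a monomial.
data Polynomial : Set where
  const   : ℕ → Polynomial
  var     : Polynomial
  _⊕_ _⊗_ : (P Q : Polynomial) → Polynomial

eval : Polynomial → ℕ → ℕ
eval (const c) n = c
eval var       n = n
eval (P ⊕ Q)   n = eval P n + eval Q n
eval (P ⊗ Q)   n = eval P n * eval Q n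

substitute : Polynomial → Polynomial → Polynomial
substitute (const c) R = const c
substitute var       R = R
substitute (P ⊕ Q)   R = substitute P R ⊕ substitute Q R
substitute (P ⊗ Q)   R = substitute P R ⊗ substitute Q R

eval-substitute : ∀ P R n → eval (substitute P R) n ≡ eval P (eval R n)
eval-substitute (const c) R n = refl
eval-substitute var       R n = refl
eval-substitute (P ⊕ Q)   R n = cong₂ _+_ (eval-substitute P R n) (eval-substitute Q R n)
eval-substitute (P ⊗ Q)   R n = cong₂ _*_ (eval-substitute P R n) (eval-substitute Q R n)

eval-mono : ∀ P {m n} → m ≤ n → eval P m ≤ eval P n
eval-mono (const c) h = ≤-refl
eval-mono var       h = h
eval-mono (P ⊕ Q)   h = +-mono-≤ (eval-mono P h) (eval-mono Q h)
eval-mono (P ⊗ Q)   h = *-mono-≤ (eval-mono P h) (eval-mono Q h)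

power : Polynomial → ℕ → Polynomial
power P zero    = const 1
power P (suc k) = P ⊗ power P k

eval-power : ∀ P k n → eval (power P k) n ≡ eval P n ^ k
eval-power P zero    n = refl
eval-power P (suc k) n = cong (eval P n *_) (eval-power P k n)

-- A common exponent for sums relies on `n ^ k ≤ n ^ (k + l)`, hence on `1 ≤ n`: at 0 a positive
-- power cannot absorb a constant term.
eval-monomial : ∀ P → Σ[ c ∈ ℕ ] Σ[ k ∈ ℕ ] (∀ n → 1 ≤ n → eval P n ≤ c * n ^ k)
eval-monomial (const c) = c , 0 , λ n _ → ≤-reflexive (sym (*-identityʳ c))
eval-monomial var       = 1 , 1 , λ n _ → ≤-reflexive (sym (trans (*-identityˡ (n ^ 1)) (*-identityʳ n)))
eval-monomial (P ⊕ Q) with eval-monomial P | eval-monomial Q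
... | c , k , p | d , l , q = c + d , k + l , bound
  where
  bound : ∀ n → 1 ≤ n → eval P n + eval Q n ≤ (c + d) * n ^ (k + l)
  bound n@(suc _) h = begin
    eval P n + eval Q n                   ≤⟨ +-mono-≤ (p n h) (q n h) ⟩
    c * n ^ k + d * n ^ l                 ≤⟨ +-mono-≤ (*-monoʳ-≤ c (^-monoʳ-≤ n (m≤m+n k l)))
                                                      (*-monoʳ-≤ d (^-monoʳ-≤ n (m≤n+m l k))) ⟩
    c * n ^ (k + l) + d * n ^ (k + l)     ≡⟨ *-distribʳ-+ (n ^ (k + l)) c d ⟨
    (c + d) * n ^ (k + l)                 ∎
    where open ≤-Reasoning
eval-monomial (P ⊗ Q) with eval-monomial P | eval-monomial Q
... | c , k , p | d , l , q = c * d , k + l , bound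
  where
  bound : ∀ n → 1 ≤ n → eval P n * eval Q n ≤ c * d * n ^ (k + l)
  bound n h = begin
    eval P n * eval Q n         ≤⟨ *-mono-≤ (p n h) (q n h) ⟩
    c * n ^ k * (d * n ^ l)     ≡⟨ [m*n]*[o*p]≡[m*o]*[n*p] c (n ^ k) d (n ^ l) ⟩
    c * d * (n ^ k * n ^ l)     ≡⟨ cong (c * d *_) (^-distribˡ-+-* n k l) ⟨
    c * d * n ^ (k + l)         ∎
    where open ≤-Reasoning

-- Shattering by families of equivalence relations

length-cartesianProduct : ∀ {A B : Set} (xs : List A) (ys : List B) →
                          length (cartesianProduct xs ys) ≡ length xs * length ys
length-cartesianProduct []       ys = refl
length-cartesianProduct (x ∷ xs) ys =
  trans (length-++ (List.map (x ,_) ys))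
        (cong₂ _+_ (length-map (x ,_) ys) (length-cartesianProduct xs ys))

module _ (lem : ExcludedMiddle 0ℓ) {X Y : Set} (E : X → Y → Y → Set)
         (E-sym : ∀ x {y y′} → E x y y′ → E x y′ y)
         (E-trans : ∀ x {y y′ y″} → E x y y′ → E x y′ y″ → E x y y″) where

  Agree : List X → Y → Y → Set
  Agree xs y y′ = Allˡ (λ x → E x y y′) xs

  Cover : Pred Y 0ℓ → List X → List Y → Set
  Cover P xs L = ∀ y → P y → Any (λ r → P r × Agree xs y r) L

  -- Shattering in Natarajan's sense: a point may have many classes, so two of them are singled out
  -- at each point. The points are automatically distinct, since at a repeated point the patterns
  -- would force `r i` and `s i` together.
  Shattered : ℕ → List X → Pred Y 0ℓ → Set
  Shattered N xs P =
    Σ[ z ∈ (Fin N → X) ] (∀ i → z i ∈ˡ xs) × (Σ[ r ∈ (Fin N → Y) ] Σ[ s ∈ (Fin N → Y) ]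
      (∀ i → ¬ E (z i) (r i) (s i)) ×
      (∀ (J : Fin N → Bool) → Σ[ y ∈ Y ] P y × (∀ i → E (z i) y (if J i then r i else s i))))

  -- For inequivalent `r` and `s`, these are the elements that counting traces on `xs` alone would
  -- miss: the twin `y′` has the same trace on `xs` but another class at `x`.
  Split : Pred Y 0ℓ → X → List X → Y × Y → Pred Y 0ℓ
  Split P x xs (r , s) y = P y × E x y r × Σ[ y′ ∈ Y ] (P y′ × E x y′ s × Agree xs y y′)

  module _ {K : ℕ} (R : X → List Y) (#R : ∀ x → length (R x) ≤ K)
           (R-covers : ∀ x y → Any (E x y) (R x)) where

    private
      bound : List X → ℕ → ℕ
      bound xs N = (1 + length xs * (K * K)) ^ N

      -- The count f(n, N) for n points obeys f(n + 1, N + 1) ≤ f(n, N + 1) + K² f(n, N). With β = 1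
      -- + n K², the powers of β solve this because β^(N+1) + K² β^N = (β + K²) β^N ≤ (β +
      -- K²)^(N+1).
      bound-step : ∀ x xs N {a b c} → a ≤ bound xs (suc N) → c ≤ K * K → b ≤ c * bound xs N →
                   a + b ≤ bound (x ∷ xs) (suc N)
      bound-step x xs N {a} {b} {c} a≤ c≤ b≤ = begin
        a + b                           ≤⟨ +-mono-≤ a≤ (≤-trans b≤ (*-monoˡ-≤ (β ^ N) c≤)) ⟩
        β * β ^ N + K * K * β ^ N       ≡⟨ *-distribʳ-+ (β ^ N) β (K * K) ⟨
        (β + K * K) * β ^ N             ≤⟨ *-monoʳ-≤ (β + K * K) (^-monoˡ-≤ N (m≤m+n β (K * K))) ⟩
        (β + K * K) ^ suc N             ≡⟨ cong (λ t → (1 + t) ^ suc N) (+-comm (length xs * (K * K)) (K * K)) ⟩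
        bound (x ∷ xs) (suc N)          ∎
        where
        open ≤-Reasoning
        β = 1 + length xs * (K * K)

      -- An element `y` of the split set that realises a pattern on the old points serves class `r`
      -- at `x`. Its twin agrees with it on `xs`, hence at every `z i`, and serves class `s`.
      adjoin : ∀ {N P x xs r s} → ¬ E x r s →
               Shattered N xs (Split P x xs (r , s)) → Shattered (suc N) (x ∷ xs) P
      adjoin {N} {P} {x} {xs} {r} {s} r≁s (z , z∈ , a , b , a≁b , realise) =
        x Vector.∷ z , z∈′ , r Vector.∷ a , s Vector.∷ b , ≁ , realise′
        where
        z∈′ : ∀ i → (x Vector.∷ z) i ∈ˡ x ∷ xs
        z∈′ zero    = here refl
        z∈′ (suc i) = there (z∈ i)

        ≁ : ∀ i → ¬ E ((x Vector.∷ z) i) ((r Vector.∷ a) i) ((s Vector.∷ b) i)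
        ≁ zero    = r≁s
        ≁ (suc i) = a≁b i

        RealisedBy : (Fin (suc N) → Bool) → Y → Set
        RealisedBy J y = ∀ i → E ((x Vector.∷ z) i) y (if J i then (r Vector.∷ a) i else (s Vector.∷ b) i)

        realise′ : ∀ J → Σ[ y ∈ Y ] P y × RealisedBy J y
        realise′ J with J zero in J₀ | realise (J ∘ suc)
        ... | true  | y , (Py , y~r , _) , y~ = y , Py , y-realises
          where
          y-realises : RealisedBy J y
          y-realises zero rewrite J₀ = y~r
          y-realises (suc i) = y~ i
        ... | false | y , (_ , _ , y′ , Py′ , y′~s , y~y′) , y~ = y′ , Py′ , y-realises
          where
          y-realises : RealisedBy J y′
          y-realises zero rewrite J₀ = y′~s
          y-realises (suc i) = E-trans (z i) (E-sym (z i) (AllL.lookup y~y′ (z∈ i))) (y~ i)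

      -- Induction on the list of pairs. A pair within one class is skipped; for any other, a
      -- shattered split set gains the point `x` by `adjoin`, and a covered one contributes its
      -- list.
      coverSplits : ∀ N P x xs →
        (∀ Q → Shattered N xs Q ⊎ (Σ[ L ∈ List Y ] length L ≤ bound xs N × Cover Q xs L)) →
        ∀ ps → Shattered (suc N) (x ∷ xs) P ⊎
               (Σ[ L ∈ List Y ] length L ≤ length ps * bound xs N ×
                 (∀ {r s} → (r , s) ∈ˡ ps → ¬ E x r s → Cover (Split P x xs (r , s)) xs L))
      coverSplits N P x xs ih [] = inj₂ ([] , z≤n , λ ())
      coverSplits N P x xs ih ((r , s) ∷ ps) with coverSplits N P x xs ih ps
      ... | inj₁ sh = inj₁ sh
      ... | inj₂ (L , #L , cov) with lem {E x r s} | ih (Split P x xs (r , s))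
      ...   | yes r~s | _ = inj₂ (L , ≤-trans #L (m≤n+m _ (bound xs N)) ,
              λ { (here refl) r≁s → ⊥-elim (r≁s r~s) ; (there p) → cov p })
      ...   | no r≁s | inj₁ sh = inj₁ (adjoin r≁s sh)
      ...   | no r≁s | inj₂ (L′ , #L′ , cov′) = inj₂
              ( L′ List.++ L
              , ≤-trans (≤-reflexive (length-++ L′)) (+-mono-≤ #L′ #L)
              , λ { (here refl) _ y Py → ++⁺ˡ (cov′ y Py)
                  ; (there p) r≁s y Py → ++⁺ʳ L′ (cov p r≁s y Py) })

    -- Induction on the points and `N`. Let `c` represent `y` on `xs`. If both have the same class
    -- at `x`, then `c` still represents `y` on `x ∷ xs`. Otherwise `y` lies in the split set for
    -- the representatives of the two classes, with `c` as twin, and every member of that set is in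
    -- the class of `y` at `x`.
    shattered-or-covered : ∀ N xs P →
      Shattered N xs P ⊎
      (Σ[ L ∈ List Y ] length L ≤ (1 + length xs * (K * K)) ^ N × Cover P xs L)
    -- Any element of `P` shatters zero points, so only an empty `P` is left to be covered.
    shattered-or-covered zero xs P with lem {Σ[ y ∈ Y ] P y}
    ... | yes (y , Py) = inj₁ ((λ ()) , (λ ()) , (λ ()) , (λ ()) , (λ ()) , λ _ → y , Py , λ ())
    ... | no ∄y        = inj₂ ([] , z≤n , λ y Py → ⊥-elim (∄y (y , Py)))
    shattered-or-covered (suc N) [] P with lem {Σ[ y ∈ Y ] P y}
    ... | yes (y , Py) = inj₂ (y ∷ [] , m^n>0 1 (suc N) , λ _ _ → here (Py , []))
    ... | no ∄y        = inj₂ ([] , z≤n , λ y Py → ⊥-elim (∄y (y , Py)))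
    shattered-or-covered (suc N) (x ∷ xs) P
      with shattered-or-covered (suc N) xs P
         | coverSplits N P x xs (shattered-or-covered N xs) (cartesianProduct (R x) (R x))
    ... | inj₁ (z , z∈ , sh) | _ = inj₁ (z , there ∘ z∈ , sh)
    ... | inj₂ _ | inj₁ sh = inj₁ sh
    ... | inj₂ (L , #L , cov) | inj₂ (L′ , #L′ , cov′) = inj₂ (L List.++ L′ , #L++L′ , cov″)
      where
      #L++L′ : length (L List.++ L′) ≤ (1 + length (x ∷ xs) * (K * K)) ^ suc N
      #L++L′ = ≤-trans (≤-reflexive (length-++ L))
        (bound-step x xs N #L
          (≤-trans (≤-reflexive (length-cartesianProduct (R x) (R x))) (*-mono-≤ (#R x) (#R x)))
          #L′)

      cov″ : Cover P (x ∷ xs) (L List.++ L′)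
      cov″ y Py with find (cov y Py) | find (R-covers x y)
      ... | c , c∈L , Pc , y~c | r , r∈ , y~r with find (R-covers x c)
      ...   | s , s∈ , c~s with lem {E x r s}
      ...     | yes r~s = ++⁺ˡ (lose c∈L (Pc , E-trans x y~r (E-trans x r~s (E-sym x c~s)) ∷ y~c))
      ...     | no r≁s = ++⁺ʳ L (Any.map
                  (λ ((Pd , d~r , _) , y~d) → Pd , E-trans x y~r (E-sym x d~r) ∷ y~d)
                  (cov′ (∈-cartesianProduct⁺ r∈ s∈) r≁s y (Py , y~r , c , Pc , c~s , y~c)))

-- Indices of induced subgraphs

enum-∈ : ∀ {n} (S : Subset n) i → enum S i Subset.∈ S
enum-∈ (inside  ∷ S) zero    = here
enum-∈ (inside  ∷ S) (suc i) = there (enum-∈ S i)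
enum-∈ (outside ∷ S) i       = there (enum-∈ S i)

index : ∀ {n} (S : Subset n) {v} → v Subset.∈ S → Fin ∣ S ∣
index (inside  ∷ S) here      = zero
index (inside  ∷ S) (there h) = suc (index S h)
index (outside ∷ S) (there h) = index S h

enum-index : ∀ {n} (S : Subset n) {v} (h : v Subset.∈ S) → enum S (index S h) ≡ v
enum-index (inside  ∷ S) here      = refl
enum-index (inside  ∷ S) (there h) = cong suc (enum-index S h)
enum-index (outside ∷ S) (there h) = cong suc (enum-index S h)

enum-injective : ∀ {n} (S : Subset n) {i j} → enum S i ≡ enum S j → i ≡ j
enum-injective (inside  ∷ S) {zero}  {zero}  e = refl
enum-injective (inside  ∷ S) {suc i} {suc j} e = cong suc (enum-injective S (suc-injective e))
enum-injective (outside ∷ S) e = enum-injective S (suc-injective e)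

enum-indices : ∀ {n k} (S : Subset n) {v : Vec (Fin n) k} → All (Subset._∈ S) v →
               ∃[ w ] map (enum S) w ≡ v
enum-indices S [] = [] , refl
enum-indices S (h ∷ hs) with enum-indices S hs
... | w , e = index S h ∷ w , cong₂ _∷_ (enum-index S h) e

fromPred : ExcludedMiddle 0ℓ → ∀ {n} (P : Pred (Fin n) 0ℓ) → Σ[ S ∈ Subset n ] (∀ v → v Subset.∈ S ⇔ P v)
fromPred lem {zero}  P = [] , λ ()
fromPred lem {suc n} P with fromPred lem (P ∘ suc) | lem {P zero}
... | S , h | yes p = inside ∷ S , λ
  { zero    → mk⇔ (λ _ → p) (λ _ → here)
  ; (suc v) → mk⇔ (to (h v) ∘ drop-there) (there ∘ from (h v)) }
... | S , h | no ¬p = outside ∷ S , λ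
  { zero    → mk⇔ (λ ()) (⊥-elim ∘ ¬p)
  ; (suc v) → mk⇔ (to (h v) ∘ drop-there) (there ∘ from (h v)) }

-- Simple structures as graphs

T-does : ∀ {a} {A : Set a} (a? : Dec A) → T (does a?) ⇔ A
T-does (yes a) = mk⇔ (λ _ → a) (λ _ → tt)
T-does (no ¬a) = mk⇔ (λ ()) ¬a

finite-simple⇒AllGraphs : ExcludedMiddle 0ℓ → ∀ (A : Structure (graphSignature 0)) {m} →
  Carrier A ↔ Fin m → (∀ a b → binary A tt a b → binary A tt b a) →
  (∀ a → ¬ binary A tt a a) → ∃[ H ] A ≅ ⟦ H ⟧
finite-simple⇒AllGraphs lem A {m} bij symmetric irreflexive = H , record
  { bijection = bij
  ; unary-⇔   = λ ()
  ; binary-⇔  = λ _ a b → subst₂ (λ a′ b′ → binary A tt a b ⇔ T (does (edge? a′ b′)))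
                  (sym (strictlyInverseʳ a)) (sym (strictlyInverseʳ b))
                  (⇔.sym (T-does (edge? a b)))
  }
  where
  open Inverse bij using (strictlyInverseʳ) renaming (from to vertex)
  edge? : ∀ a b → Dec (binary A tt a b)
  edge? a b = lem
  H : Graph 0
  H = record
    { order      = m
    ; adj        = λ u v → does (edge? (vertex u) (vertex v))
    ; adj-sym    = λ u v → does-⇔ (mk⇔ (symmetric _ _) (symmetric _ _))
                             (edge? (vertex u) (vertex v)) (edge? (vertex v) (vertex u))
    ; adj-irrefl = λ v → dec-false (edge? (vertex v) (vertex v)) (irreflexive (vertex v))
    ; color      = λ ()
    }

-- Shattering in monadically NIP classes

coloured : ∀ {p} (G : Graph p) {q} → Vector (Pred (Vertex G) 0ℓ) q →
           Structure (withUnary q (graphSignature p))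
coloured G U = expand ⟦ G ⟧ U

ShattersVertices : ∀ {p q} (G : Graph p) → Vector (Pred (Vertex G) 0ℓ) q →
           Formula (withUnary q (graphSignature p)) 2 → ℕ → Set
ShattersVertices G U ψ N =
  Σ[ z ∈ Vector (Vertex G) N ] ∀ (J : Fin N → Bool) →
    Σ[ y ∈ Vertex G ] (∀ i → (coloured G U ⊨ ψ [ y ∷ z i ∷ [] ]) ⇔ T (J i))

-- With `ψ` read as incidence, the vertices of colour `u` act as subdivision vertices of edges; the
-- inequality excludes loops.
commonNeighbour : ∀ {𝒮} → Unary 𝒮 → Formula 𝒮 2 → Formula 𝒮 2
commonNeighbour u ψ = and (neg (equal zero (suc zero)))
  (exists (and (atom₁ u zero) (and (relabel id id (lookup (zero ∷ suc zero ∷ [])) ψ)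
                                   (relabel id id (lookup (zero ∷ suc (suc zero) ∷ [])) ψ))))

⊨-commonNeighbour : ∀ {𝒮} (A : Structure 𝒮) u ψ v w →
  (A ⊨ commonNeighbour u ψ [ v ∷ w ∷ [] ]) ⇔
  (¬ v ≡ w × Σ[ y ∈ Carrier A ] unary A u y × (A ⊨ ψ [ y ∷ v ∷ [] ]) × (A ⊨ ψ [ y ∷ w ∷ [] ]))
⊨-commonNeighbour A u ψ v w = mk⇔
  (λ (v≢w , y , uy , p , q) → v≢w , y , uy , to (l y) p , to (r y) q)
  (λ (v≢w , y , uy , p , q) → v≢w , y , uy , from (l y) p , from (r y) q)
  where
  l : ∀ y → _ ⇔ (A ⊨ ψ [ y ∷ v ∷ [] ])
  l y = ⊨-relabel id id {A = A} {B = A} ≅-refl _ ψ λ { zero → refl ; (suc zero) → refl }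
  r : ∀ y → _ ⇔ (A ⊨ ψ [ y ∷ w ∷ [] ])
  r y = ⊨-relabel id id {A = A} {B = A} ≅-refl _ ψ λ { zero → refl ; (suc zero) → refl }

module _ {p q} (ψ : Formula (withUnary q (graphSignature p)) 2) where

  private
    skip : Fin p ⊎ Fin q → Fin p ⊎ Fin (2 + q)
    skip = [ inj₁ , (λ i → inj₂ (suc (suc i))) ]′

    ψ⁺ : Formula (withUnary (2 + q) (withM (graphSignature p))) 2
    ψ⁺ = relabel skip inj₁ id ψ

  -- The first new colour marks the shattered vertices, which become the
  -- vertices of the output; the second marks one vertex per output edge ij,
  -- shattering off exactly {i , j}.
  incidenceTransduction : Transduction (graphSignature p) (graphSignature 0)
  incidenceTransduction = record
    { #copies        = 1
    ; #unary         = 2 + q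
    ; interpretation = record
      { domain = atom₁ (inj₂ zero) zero
      ; rel₁   = λ ()
      ; rel₂   = λ _ → commonNeighbour (inj₂ (suc zero)) ψ⁺
      }
    }

  -- Whatever the colours are, the edge formula is symmetric and irreflexive by its shape, and the
  -- universe is a colour class of a finite structure.
  incidence⊆AllGraphs : ExcludedMiddle 0ℓ → ∀ (G : Graph p) {B} →
                        B ∈⟨ incidenceTransduction ⟩ ⟦ G ⟧ → AllGraphs B
  incidence⊆AllGraphs lem G (U , B≅) =
    let H , A≅H = finite-simple⇒AllGraphs lem A bij symmetric irreflexive in
    H , ≅-trans B≅ A≅H
    where
    M = expand (copies 1 ⟦ G ⟧) U
    A = interpret (Transduction.interpretation incidenceTransduction) M
    edge = ⊨-commonNeighbour M (inj₂ (suc zero)) ψ⁺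

    symmetric : ∀ a b → binary A tt a b → binary A tt b a
    symmetric a b e with to (edge (value a) (value b)) e
    ... | a≢b , y , Yy , p , q = from (edge (value b) (value a)) (a≢b ∘ sym , y , Yy , q , p)

    irreflexive : ∀ a → ¬ binary A tt a a
    irreflexive a (a≢a , _) = a≢a refl

    S = proj₁ (fromPred lem (λ v → U zero (zero , v)))
    S⇔ = proj₂ (fromPred lem (λ v → U zero (zero , v)))

    -- The refinement carries its proof irrelevantly; since membership in `S` is decidable, it can
    -- be recomputed.
    ∈S : (a : Carrier A) → proj₂ (value a) Subset.∈ S
    ∈S ((zero , v) ▹ Irrelevant.[ h ]) = recompute (v ∈? S) (from (S⇔ v) h)

    bij : Carrier A ↔ Fin ∣ S ∣
    bij = mk↔ₛ′
      (λ a → index S (∈S a))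
      (λ i → (zero , enum S i) ▹ Irrelevant.[ to (S⇔ (enum S i)) (enum-∈ S i) ])
      (λ i → enum-injective S (enum-index S _))
      (λ { a@((zero , v) ▹ _) → value-injective (cong (zero ,_) (enum-index S (∈S a))) })

  -- The pattern {k, l} yields a vertex `y k l` that `ψ` links to `z k` and `z l` and to no other
  -- point. When those belonging to edges are marked, distinct `z i` and `z j` have a marked common
  -- neighbour exactly if ij is an edge.
  shatters⇒incidence : ∀ (G : Graph p) U (H : Graph 0) → ShattersVertices G U ψ (order H) →
                       ∀ {B} → B ≅ ⟦ H ⟧ → B ∈⟨ incidenceTransduction ⟩ ⟦ G ⟧
  shatters⇒incidence G U H (z , shatter) B≅H = U⁺ , ≅-trans B≅H record
    { bijection = mk↔ₛ′ vertex unvertex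
        (λ { a@((zero , v) ▹ h) → value-injective (cong (zero ,_) (sym (proj₂ (origin a)))) })
        (λ i → z-injective (sym (proj₂ (origin (vertex i)))))
    ; unary-⇔   = λ ()
    ; binary-⇔  = λ _ i j → ⇔.trans (mk⇔ (forth i j) (back i j)) (⇔.sym (edge (zero , z i) (zero , z j)))
    }
    where
    pair : (k l i : Fin (order H)) → Dec (i ≡ k ⊎ i ≡ l)
    pair k l i = (i ≟ᶠ k) ⊎-dec (i ≟ᶠ l)

    y : (k l : Fin (order H)) → Vertex G
    y k l = proj₁ (shatter (does ∘ pair k l))

    y-spec : ∀ k l i → (coloured G U ⊨ ψ [ y k l ∷ z i ∷ [] ]) ⇔ (i ≡ k ⊎ i ≡ l)
    y-spec k l i = ⇔.trans (proj₂ (shatter (does ∘ pair k l)) i) (T-does (pair k l i))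

    -- The singleton pattern {j}, obtained as {j, j}, separates `z j` from the other points.
    z-injective : ∀ {i j} → z i ≡ z j → i ≡ j
    z-injective {i} {j} e
      with to (y-spec j j i) (subst (λ v → coloured G U ⊨ ψ [ y j j ∷ v ∷ [] ]) (sym e)
                                    (from (y-spec j j j) (inj₁ refl)))
    ... | inj₁ i≡j = i≡j
    ... | inj₂ i≡j = i≡j

    U⁺ : Fin (2 + q) → Pred (Fin 1 × Vertex G) 0ℓ
    U⁺ zero          (_ , v) = Σ[ i ∈ Fin (order H) ] v ≡ z i
    U⁺ (suc zero)    (_ , v) = Σ[ k ∈ Fin (order H) ] Σ[ l ∈ Fin (order H) ] T (adj H k l) × v ≡ y k l
    U⁺ (suc (suc i)) (_ , v) = U i v

    M = expand (copies 1 ⟦ G ⟧) U⁺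
    A = interpret (Transduction.interpretation incidenceTransduction) M
    edge = ⊨-commonNeighbour M (inj₂ (suc zero)) ψ⁺

    -- Forgetting `M` and the two new colours leaves the original coloured graph, as there is only
    -- one copy.
    M≅ : reduct skip inj₁ M ≅ coloured G U
    M≅ = record
      { bijection = mk↔ₛ′ proj₂ (zero ,_) (λ _ → refl) (λ { (zero , _) → refl })
      ; unary-⇔   = λ { (inj₁ c) _ → ⇔.refl ; (inj₂ i) _ → ⇔.refl }
      ; binary-⇔  = λ { tt (zero , _) (zero , _) → mk⇔ proj₂ (refl ,_) }
      }

    ψ⁺-spec : ∀ y x → (M ⊨ ψ⁺ [ y ∷ x ∷ [] ]) ⇔ (coloured G U ⊨ ψ [ proj₂ y ∷ proj₂ x ∷ [] ])
    ψ⁺-spec y x = ⊨-relabel skip inj₁ M≅ id ψ λ { zero → refl ; (suc zero) → refl }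

    vertex : Fin (order H) → Carrier A
    vertex i = (zero , z i) ▹ Irrelevant.[ i , refl ]

    origin : (a : Carrier A) → Σ[ i ∈ Fin (order H) ] proj₂ (value a) ≡ z i
    origin ((_ , v) ▹ Irrelevant.[ h ]) = recompute (any? λ i → v ≟ᶠ z i) h

    unvertex : Carrier A → Fin (order H)
    unvertex a = proj₁ (origin a)

    Edge : Fin (order H) → Fin (order H) → Set
    Edge i j = ¬ (zero , z i) ≡ (zero , z j) × Σ[ w ∈ Carrier M ] U⁺ (suc zero) w ×
               (M ⊨ ψ⁺ [ w ∷ (zero , z i) ∷ [] ]) × (M ⊨ ψ⁺ [ w ∷ (zero , z j) ∷ [] ])

    forth : ∀ i j → T (adj H i j) → Edge i j
    forth i j ij =
        (λ e → subst T (adj-irrefl H i) (subst (T ∘ adj H i) (sym (z-injective (cong proj₂ e))) ij))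
      , (zero , y i j) , (i , j , ij , refl)
      , from (ψ⁺-spec _ _) (from (y-spec i j i) (inj₁ refl))
      , from (ψ⁺-spec _ _) (from (y-spec i j j) (inj₂ refl))

    back : ∀ i j → Edge i j → T (adj H i j)
    back i j (i≢j , (zero , _) , (k , l , kl , refl) , p , q)
      with to (y-spec k l i) (to (ψ⁺-spec _ _) p) | to (y-spec k l j) (to (ψ⁺-spec _ _) q)
    ... | inj₁ refl | inj₁ refl = ⊥-elim (i≢j refl)
    ... | inj₁ refl | inj₂ refl = kl
    ... | inj₂ refl | inj₁ refl = subst T (adj-sym H k l) kl
    ... | inj₂ refl | inj₂ refl = ⊥-elim (i≢j refl)

module _ (lem : ∀ ℓ → ExcludedMiddle ℓ) {ℓ p} {𝒞 : GraphClass p ℓ} (nip : MonadicallyNIP 𝒞) where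

  -- If no `N` worked, then for every graph H some member of `𝒞` would shatter `order H` vertices
  -- and so yield H, and the incidence transduction would produce exactly all graphs.
  shattering-bounded : ∀ {q} (ψ : Formula (withUnary q (graphSignature p)) 2) →
    Σ[ N ∈ ℕ ] (∀ G → 𝒞 G → ∀ U → ¬ ShattersVertices G U ψ N)
  shattering-bounded ψ
    with lem (lsuc 0ℓ ⊔ˡ ℓ) {Σ[ N ∈ ℕ ] (∀ G → 𝒞 G → ∀ U → ¬ ShattersVertices G U ψ N)}
  ... | yes bounded = bounded
  ... | no unbounded = ⊥-elim (nip (incidenceTransduction ψ)
    ( (λ (G , _ , B∈) → incidence⊆AllGraphs ψ (lem 0ℓ) G B∈)
    , λ {B} (H , B≅H) → decidable-stable (lem (lsuc 0ℓ ⊔ˡ ℓ)) λ B∉ →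
        unbounded (order H , λ G G∈ U sh → B∉ (G , G∈ , shatters⇒incidence ψ G U H sh B≅H))))

-- Types over a set

SameType : ∀ {𝒮 m} (M : Structure 𝒮) → Formula 𝒮 (suc m) → Pred (Carrier M) 0ℓ →
           Carrier M → Carrier M → Set
SameType {m = m} M ψ A y y′ =
  ∀ (xs : Vec (Carrier M) m) → All A xs → (M ⊨ ψ [ y ∷ xs ]) ⇔ (M ⊨ ψ [ y′ ∷ xs ])

-- The polynomial is uniform over all colourings `U`, because the induction on the number of
-- parameters names vertices by new colours.
TypesBounded : ∀ {p q ℓ m} → GraphClass p ℓ → Formula (withUnary q (graphSignature p)) (suc m) → Set (lsuc 0ℓ ⊔ˡ ℓ)
TypesBounded 𝒞 ψ = Σ[ Q ∈ Polynomial ] ∀ G → 𝒞 G → ∀ U (A : Subset (order G)) →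
  Σ[ L ∈ List (Vertex G) ] length L ≤ eval Q ∣ A ∣ ×
    (∀ y → Any (SameType (coloured G U) ψ (Subset._∈ A) y) L)

shift : ∀ {A : Set} {q} → A ⊎ Fin q → A ⊎ Fin (suc q)
shift (inj₁ c) = inj₁ c
shift (inj₂ i) = inj₂ (suc i)

coloured-∷ : ∀ {p q} (G : Graph p) (P : Pred (Vertex G) 0ℓ) (U : Vector (Pred (Vertex G) 0ℓ) q) →
             reduct shift id (coloured G (P Vector.∷ U)) ≅ coloured G U
coloured-∷ G P U = record
  { bijection = ↔-refl
  ; unary-⇔   = λ { (inj₁ c) _ → ⇔.refl ; (inj₂ i) _ → ⇔.refl }
  ; binary-⇔  = λ _ _ _ → ⇔.refl
  }

module _ {p q : ℕ} {m : ℕ} (ψ : Formula (withUnary q (graphSignature p)) (suc (suc m))) where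

  private
    swap : Fin (2 + m) → Fin (2 + m)
    swap zero          = suc zero
    swap (suc zero)    = zero
    swap (suc (suc i)) = suc (suc i)

    -- The block `xs` bound by `allIn` precedes `y` and `x` in the environment; `σ₂` replaces `y` by
    -- the named vertex, bound in front of everything.
    σ₁ : Fin (2 + m) → Fin (m + 2)
    σ₁ zero          = m ↑ʳ zero
    σ₁ (suc zero)    = m ↑ʳ suc zero
    σ₁ (suc (suc i)) = i ↑ˡ 2

    σ₂ : Fin (2 + m) → Fin (suc (m + 2))
    σ₂ zero          = zero
    σ₂ (suc zero)    = suc (m ↑ʳ suc zero)
    σ₂ (suc (suc i)) = suc (i ↑ˡ 2)

  -- Trades the first parameter for a colour meant to be a singleton. The vertex bound by the
  -- quantifier takes the place of that parameter, behind `y`, whence `swap`.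
  nameFirst : Formula (withUnary (1 + q) (graphSignature p)) (suc m)
  nameFirst = exists (and (atom₁ (inj₂ zero) zero) (relabel shift id swap ψ))

  ⊨-nameFirst : ∀ G U (a : Vertex G) y xs →
    (coloured G ((_≡ a) Vector.∷ U) ⊨ nameFirst [ y ∷ xs ]) ⇔ (coloured G U ⊨ ψ [ y ∷ a ∷ xs ])
  ⊨-nameFirst G U a y xs = mk⇔ (λ { (_ , refl , h) → to (spec a) h }) (λ h → a , refl , from (spec a) h)
    where
    spec : ∀ b → (coloured G ((_≡ a) Vector.∷ U) ⊨ relabel shift id swap ψ [ b ∷ y ∷ xs ]) ⇔
                 (coloured G U ⊨ ψ [ y ∷ b ∷ xs ])
    spec b = ⊨-relabel shift id (coloured-∷ G (_≡ a) U) swap ψ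
      λ { zero → refl ; (suc zero) → refl ; (suc (suc i)) → refl }

  private
    ofVertex ofNamed : Formula (withUnary (2 + q) (graphSignature p)) (m + 2)
    ofVertex = relabel (shift ∘ shift) id σ₁ ψ
    ofNamed = exists (and (atom₁ (inj₂ (suc zero)) zero) (relabel (shift ∘ shift) id σ₂ ψ))

  -- The two new colours are meant to be the set A and a singleton {y₀}.
  sameTypeAsNamed : Formula (withUnary (2 + q) (graphSignature p)) 2
  sameTypeAsNamed = allIn (inj₂ zero) m (iff ofVertex ofNamed)

  ⊨-sameTypeAsNamed : ExcludedMiddle 0ℓ → ∀ G U (A : Pred (Vertex G) 0ℓ) y₀ y x →
    (coloured G (A Vector.∷ (_≡ y₀) Vector.∷ U) ⊨ sameTypeAsNamed [ y ∷ x ∷ [] ]) ⇔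
    (∀ (xs : Vec (Vertex G) m) → All A xs →
      (coloured G U ⊨ ψ [ y ∷ x ∷ xs ]) ⇔ (coloured G U ⊨ ψ [ y₀ ∷ x ∷ xs ]))
  ⊨-sameTypeAsNamed lem G U A y₀ y x = mk⇔
    (λ h xs xs∈ → ⇔.trans (⇔.sym (ofVertex-spec xs)) (⇔.trans
      (to (⊨-iff lem M ofVertex ofNamed) (to (⊨-allIn lem M (inj₂ zero) m _) h xs xs∈)) (ofNamed-spec xs)))
    (λ h → from (⊨-allIn lem M (inj₂ zero) m (iff ofVertex ofNamed)) λ xs xs∈ →
      from (⊨-iff lem M ofVertex ofNamed) (⇔.trans (ofVertex-spec xs) (⇔.trans (h xs xs∈) (⇔.sym (ofNamed-spec xs)))))
    where
    M = coloured G (A Vector.∷ (_≡ y₀) Vector.∷ U)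

    M≅ : reduct (shift ∘ shift) id M ≅ coloured G U
    M≅ = record
      { bijection = ↔-refl
      ; unary-⇔   = λ { (inj₁ c) _ → ⇔.refl ; (inj₂ i) _ → ⇔.refl }
      ; binary-⇔  = λ _ _ _ → ⇔.refl
      }

    ofVertex-spec : ∀ xs → (M ⊨ ofVertex [ xs ++ y ∷ x ∷ [] ]) ⇔ (coloured G U ⊨ ψ [ y ∷ x ∷ xs ])
    ofVertex-spec xs = ⊨-relabel (shift ∘ shift) id M≅ σ₁ ψ λ
      { zero → lookup-++ʳ xs (y ∷ x ∷ []) zero
      ; (suc zero) → lookup-++ʳ xs (y ∷ x ∷ []) (suc zero)
      ; (suc (suc i)) → lookup-++ˡ xs (y ∷ x ∷ []) i }

    ofNamed-spec : ∀ xs → (M ⊨ ofNamed [ xs ++ y ∷ x ∷ [] ]) ⇔ (coloured G U ⊨ ψ [ y₀ ∷ x ∷ xs ])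
    ofNamed-spec xs = mk⇔ (λ { (_ , refl , h) → to (spec y₀) h }) (λ h → y₀ , refl , from (spec y₀) h)
      where
      spec : ∀ y′ → (M ⊨ relabel (shift ∘ shift) id σ₂ ψ [ y′ ∷ xs ++ y ∷ x ∷ [] ]) ⇔
                    (coloured G U ⊨ ψ [ y′ ∷ x ∷ xs ])
      spec y′ = ⊨-relabel (shift ∘ shift) id M≅ σ₂ ψ λ
        { zero → refl
        ; (suc zero) → lookup-++ʳ xs (y ∷ x ∷ []) (suc zero)
        ; (suc (suc i)) → lookup-++ˡ xs (y ∷ x ∷ []) i }

module _ (lem : ExcludedMiddle 0ℓ) {Y : Set} where

  representative : (P : Pred Y 0ℓ) →
    Σ[ L ∈ List Y ] length L ≤ 1 × (∀ y → P y → Any P L)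
  representative P with lem {Σ[ y ∈ Y ] P y}
  ... | yes (r , Pr) = r ∷ [] , s≤s z≤n , λ _ _ → here Pr
  ... | no ∄         = [] , z≤n , λ y Py → ⊥-elim (∄ (y , Py))

  two-representatives : (P : Pred Y 0ℓ) →
    Σ[ L ∈ List Y ] length L ≤ 2 × (∀ y → Any (λ r → P y ⇔ P r) L)
  two-representatives P with representative P | representative (¬_ ∘ P)
  ... | L , #L , cov | L′ , #L′ , cov′ =
    L List.++ L′ , ≤-trans (≤-reflexive (length-++ L)) (+-mono-≤ #L #L′) , covers
    where
    covers : ∀ y → Any (λ r → P y ⇔ P r) (L List.++ L′)
    covers y with lem {P y}
    ... | yes Py = ++⁺ˡ (Any.map (λ Pr → mk⇔ (λ _ → Pr) (λ _ → Py)) (cov y Py))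
    ... | no ¬Py = ++⁺ʳ L (Any.map (λ ¬Pr → mk⇔ (⊥-elim ∘ ¬Py) (⊥-elim ∘ ¬Pr)) (cov′ y ¬Py))

module _ (lem : ∀ ℓ → ExcludedMiddle ℓ) {ℓ p} {𝒞 : GraphClass p ℓ} (nip : MonadicallyNIP 𝒞) where

  types-bounded : ∀ m {q} (ψ : Formula (withUnary q (graphSignature p)) (suc m)) → TypesBounded 𝒞 ψ
  -- The empty tuple is the only one, so the type of `y` is a truth value.
  types-bounded zero ψ = const 2 , λ G _ U A →
    let L , #L , cov = two-representatives (lem 0ℓ) (λ y → coloured G U ⊨ ψ [ y ∷ [] ]) in
    L , #L , λ y → Any.map (λ { e [] [] → e }) (cov y)
  types-bounded (suc m) {q} ψ
    with types-bounded m (nameFirst ψ) | shattering-bounded lem nip (sameTypeAsNamed ψ)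
  -- The bound (1 + n K²)^N with n = |A| points and at most K = Q(|A|) classes at each.
  ... | Q , naming-bounded | N , unshattered = power (const 1 ⊕ var ⊗ (Q ⊗ Q)) N , λ G G∈ U A →
    let module B = Bound G G∈ U A in B.L , B.#L , B.covers
    where
    module Bound (G : Graph p) (G∈ : 𝒞 G) (U : Vector (Pred (Vertex G) 0ℓ) q) (A : Subset (order G)) where
      M = coloured G U

      E : Vertex G → Vertex G → Vertex G → Set
      E x y y′ = ∀ (xs : Vec (Vertex G) m) → All (Subset._∈ A) xs →
                 (M ⊨ ψ [ y ∷ x ∷ xs ]) ⇔ (M ⊨ ψ [ y′ ∷ x ∷ xs ])

      E-sym : ∀ x {y y′} → E x y y′ → E x y′ y
      E-sym x e xs xs∈ = ⇔.sym (e xs xs∈)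

      E-trans : ∀ x {y y′ y″} → E x y y′ → E x y′ y″ → E x y y″
      E-trans x e e′ xs xs∈ = ⇔.trans (e xs xs∈) (e′ xs xs∈)

      reps = λ x → naming-bounded G G∈ ((_≡ x) Vector.∷ U) A

      reps-cover : ∀ x y → Any (E x y) (proj₁ (reps x))
      reps-cover x y = Any.map
        (λ same xs xs∈ → ⇔.trans (⇔.sym (⊨-nameFirst ψ G U x y xs))
                           (⇔.trans (same xs xs∈) (⊨-nameFirst ψ G U x _ xs)))
        (proj₂ (proj₂ (reps x)) y)

      elements : List (Vertex G)
      elements = List.tabulate (enum A)

      -- Every shattered y lies in one of two classes at each point zᵢ, so
      -- naming a single y₀ turns class membership into a formula in (y , zᵢ).
      ¬shattered : ¬ Shattered (lem 0ℓ) E E-sym E-trans N elements (λ _ → ⊤)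
      ¬shattered (z , _ , r , s , r≁s , realise) =
        unshattered G G∈ ((Subset._∈ A) Vector.∷ (_≡ y₀) Vector.∷ U)
          (z , λ J → proj₁ (realise J) , λ i → ⇔.trans
            (⊨-sameTypeAsNamed ψ (lem 0ℓ) G U (Subset._∈ A) y₀ (proj₁ (realise J)) (z i))
            (same⇔ i (J i) (proj₂ (proj₂ (realise J)) i)))
        where
        -- The constant pattern puts `y₀` in the class of `r i` at every point, so comparison with
        -- `y₀` tells the two options apart.
        y₀ = proj₁ (realise (λ _ → true))

        y₀~r : ∀ i → E (z i) y₀ (r i)
        y₀~r = proj₂ (proj₂ (realise (λ _ → true)))

        same⇔ : ∀ i b {y} → E (z i) y (if b then r i else s i) → E (z i) y y₀ ⇔ T b
        same⇔ i true  y~r = mk⇔ (λ _ → tt) (λ _ → E-trans (z i) y~r (E-sym (z i) (y₀~r i)))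
        same⇔ i false y~s = mk⇔
          (λ y~y₀ → r≁s i (E-trans (z i) (E-sym (z i) (y₀~r i)) (E-trans (z i) (E-sym (z i) y~y₀) y~s)))
          (λ ())

      cover : Σ[ L ∈ List (Vertex G) ]
                length L ≤ (1 + length elements * (eval Q ∣ A ∣ * eval Q ∣ A ∣)) ^ N ×
                Cover (lem 0ℓ) E E-sym E-trans (λ _ → ⊤) elements L
      cover with shattered-or-covered (lem 0ℓ) E E-sym E-trans (proj₁ ∘ reps)
                   (λ x → proj₁ (proj₂ (reps x))) reps-cover N elements (λ _ → ⊤)
      ... | inj₁ sh = ⊥-elim (¬shattered sh)
      ... | inj₂ c  = c

      L = proj₁ cover

      #L : length L ≤ eval (power (const 1 ⊕ var ⊗ (Q ⊗ Q)) N) ∣ A ∣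
      #L rewrite eval-power (const 1 ⊕ var ⊗ (Q ⊗ Q)) N ∣ A ∣ =
        subst (λ n → length L ≤ (1 + n * (eval Q ∣ A ∣ * eval Q ∣ A ∣)) ^ N)
              (length-tabulate (enum A)) (proj₁ (proj₂ cover))

      covers : ∀ y → Any (SameType M ψ (Subset._∈ A) y) L
      covers y = Any.map
        (λ { (_ , agree) (x ∷ xs) (x∈ ∷ xs∈) → AllL.lookup agree (elements-complete x∈) xs xs∈ })
        (proj₂ (proj₂ cover) y tt)
        where
        elements-complete : ∀ {x} → x Subset.∈ A → x ∈ˡ elements
        elements-complete x∈ =
          subst (_∈ˡ elements) (enum-index A x∈) (∈-tabulate⁺ (index A x∈))

-- Quantifier relativization along a chain of witness sets

rank : ∀ {𝒮 n} → Formula 𝒮 n → ℕ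
rank (neg φ)    = rank φ
rank (and φ ψ)  = rank φ ⊔ rank ψ
rank (or φ ψ)   = rank φ ⊔ rank ψ
rank (exists φ) = suc (rank φ)
rank (all′ φ)   = suc (rank φ)
rank _          = 0

-- All quantified subformulas share the same `C` and `D`, so that one step of the chain can serve
-- any quantifier of the formula.
Realises : ∀ {p n} (G : Graph p) → Formula (graphSignature p) n → (C D : Subset (order G)) → Set
RealisesTypes : ∀ {p n} (G : Graph p) → Formula (graphSignature p) (suc n) → (C D : Subset (order G)) → Set

RealisesTypes G ψ C D = ∀ y → Σ[ r ∈ Vertex G ] r Subset.∈ D × SameType ⟦ G ⟧ ψ (Subset._∈ C) y r

Realises G (neg φ)    C D = Realises G φ C D
Realises G (and φ ψ)  C D = Realises G φ C D × Realises G ψ C D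
Realises G (or φ ψ)   C D = Realises G φ C D × Realises G ψ C D
Realises G (exists ψ) C D = RealisesTypes G ψ C D × Realises G ψ C D
Realises G (all′ ψ)   C D = RealisesTypes G ψ C D × Realises G ψ C D
Realises G _          C D = ⊤

realises-mono : ∀ {p n} (G : Graph p) (φ : Formula (graphSignature p) n) {C D D′} →
                D Subset.⊆ D′ → Realises G φ C D → Realises G φ C D′
realises-mono G falsum        D⊆ r = tt
realises-mono G (equal x y)   D⊆ r = tt
realises-mono G (atom₁ u x)   D⊆ r = tt
realises-mono G (atom₂ e x y) D⊆ r = tt
realises-mono G (neg φ)       D⊆ r = realises-mono G φ D⊆ r
realises-mono G (and φ ψ)     D⊆ (r , s) = realises-mono G φ D⊆ r , realises-mono G ψ D⊆ s
realises-mono G (or φ ψ)      D⊆ (r , s) = realises-mono G φ D⊆ r , realises-mono G ψ D⊆ s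
realises-mono G (exists ψ)    D⊆ (t , r) =
  (λ y → let r , r∈ , same = t y in r , D⊆ r∈ , same) , realises-mono G ψ D⊆ r
realises-mono G (all′ ψ)      D⊆ (t , r) =
  (λ y → let r , r∈ , same = t y in r , D⊆ r∈ , same) , realises-mono G ψ D⊆ r

∣p∪q∣≤∣p∣+∣q∣ : ∀ {n} (p q : Subset n) → ∣ p ∪ q ∣ ≤ ∣ p ∣ + ∣ q ∣
∣p∪q∣≤∣p∣+∣q∣ []            []            = z≤n
∣p∪q∣≤∣p∣+∣q∣ (inside  ∷ p) (inside  ∷ q) =
  s≤s (≤-trans (∣p∪q∣≤∣p∣+∣q∣ p q) (+-monoʳ-≤ ∣ p ∣ (n≤1+n ∣ q ∣)))
∣p∪q∣≤∣p∣+∣q∣ (inside  ∷ p) (outside ∷ q) = s≤s (∣p∪q∣≤∣p∣+∣q∣ p q)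
∣p∪q∣≤∣p∣+∣q∣ (outside ∷ p) (inside  ∷ q) =
  ≤-trans (s≤s (∣p∪q∣≤∣p∣+∣q∣ p q)) (≤-reflexive (sym (+-suc ∣ p ∣ ∣ q ∣)))
∣p∪q∣≤∣p∣+∣q∣ (outside ∷ p) (outside ∷ q) = ∣p∪q∣≤∣p∣+∣q∣ p q

fromList : ∀ {n} → List (Fin n) → Subset n
fromList []       = Subset.⊥
fromList (x ∷ xs) = ⁅ x ⁆ ∪ fromList xs

∣fromList∣≤length : ∀ {n} (xs : List (Fin n)) → ∣ fromList xs ∣ ≤ length xs
∣fromList∣≤length {n} [] = ≤-reflexive (∣⊥∣≡0 n)
∣fromList∣≤length (x ∷ xs) = ≤-trans (∣p∪q∣≤∣p∣+∣q∣ ⁅ x ⁆ (fromList xs))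
  (+-mono-≤ (≤-reflexive (∣⁅x⁆∣≡1 x)) (∣fromList∣≤length xs))

∈-fromList : ∀ {n} {x : Fin n} {xs} → x ∈ˡ xs → x Subset.∈ fromList xs
∈-fromList {xs = x ∷ xs} (here refl) = p⊆p∪q (fromList xs) (x∈⁅x⁆ x)
∈-fromList {xs = x ∷ xs} (there h)   = q⊆p∪q ⁅ x ⁆ (fromList xs) (∈-fromList h)

-- A quantifier whose body has rank j is restricted to the new colour j, which stands for C_j. The
-- range of an outer quantifier is thus contained in the ranges of those nested in it.
relativize : ∀ {p q n} (φ : Formula (graphSignature p) n) → rank φ ≤ q → Formula (graphSignature (p + q)) n
relativize         falsum        h = falsum
relativize         (equal x y)   h = equal x y
relativize {q = q} (atom₁ u x)   h = atom₁ (u ↑ˡ q) x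
relativize         (atom₂ e x y) h = atom₂ e x y
relativize         (neg φ)       h = neg (relativize φ h)
relativize         (and φ ψ)     h =
  and (relativize φ (m⊔n≤o⇒m≤o _ _ h)) (relativize ψ (m⊔n≤o⇒n≤o (rank φ) _ h))
relativize         (or φ ψ)      h =
  or (relativize φ (m⊔n≤o⇒m≤o _ _ h)) (relativize ψ (m⊔n≤o⇒n≤o (rank φ) _ h))
relativize {p}     (exists φ)    h = exists (and (atom₁ (p ↑ʳ fromℕ< h) zero) (relativize φ (<⇒≤ h)))
relativize {p}     (all′ φ)      h = all′ (imp (atom₁ (p ↑ʳ fromℕ< h) zero) (relativize φ (<⇒≤ h)))

module _ (lem : ExcludedMiddle 0ℓ) {p} (G : Graph p) (C : ℕ → Subset (order G))
         (C-antitone : ∀ j → C (suc j) Subset.⊆ C j) (q : ℕ) where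

  private
    S = C 0

  levels : Vector (Vertex (induced G S) → Bool) q
  levels j v = does (enum S v ∈? C (toℕ j))

  private
    Ĝ = monadicLift (induced G S) levels

    ∈level : ∀ {j} (h : j < q) v → T (color Ĝ (p ↑ʳ fromℕ< h) v) ⇔ enum S v Subset.∈ C j
    ∈level h v
      rewrite Vector.lookup-++ʳ (color (induced G S)) levels (fromℕ< h) | toℕ-fromℕ< h =
      T-does (enum S v ∈? C _)

    antitone : ∀ {i j} → i ≤ j → C j Subset.⊆ C i
    antitone {i} i≤j = go (≤⇒≤′ i≤j)
      where
      go : ∀ {j} → i ≤′ j → C j Subset.⊆ C i
      go (≤′-reflexive refl) h = h
      go (≤′-step i≤′j) h = go i≤′j (C-antitone _ h)

    All-antitone : ∀ {i j k} {v : Vec (Vertex G) k} → i ≤ j →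
                   All (Subset._∈ C j) v → All (Subset._∈ C i) v
    All-antitone i≤j = All.map (antitone i≤j)

  -- A quantifier with body of rank r has its parameters in C_(r+1), and C_r realises all types over
  -- that set. A witness can therefore be exchanged for one in C_r without affecting the body. As
  -- C_(r+1) ⊆ C_r, the extended tuple lies in C_r, which the induction requires.
  ⊨-relativize : ∀ {n} (φ : Formula (graphSignature p) n) (h : rank φ ≤ q) →
    (∀ j → j < rank φ → Realises G φ (C (suc j)) (C j)) →
    ∀ w → All (Subset._∈ C (rank φ)) (map (enum S) w) →
    (⟦ G ⟧ ⊨ φ [ map (enum S) w ]) ⇔ (⟦ Ĝ ⟧ ⊨ relativize φ h [ w ])

  private
    ⊨-relativize-body : ∀ {n} (ψ : Formula (graphSignature p) (suc n)) (h : rank ψ < q) →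
      (∀ j → j ≤ rank ψ → RealisesTypes G ψ (C (suc j)) (C j) × Realises G ψ (C (suc j)) (C j)) →
      ∀ w → All (Subset._∈ C (suc (rank ψ))) (map (enum S) w) →
      ∀ i → enum S i Subset.∈ C (rank ψ) →
      (⟦ G ⟧ ⊨ ψ [ enum S i ∷ map (enum S) w ]) ⇔ (⟦ Ĝ ⟧ ⊨ relativize ψ (<⇒≤ h) [ i ∷ w ])
    ⊨-relativize-body ψ h real w w∈ i i∈ =
      ⊨-relativize ψ (<⇒≤ h) (λ j j< → proj₂ (real j (<⇒≤ j<))) (i ∷ w)
        (i∈ ∷ All.map (C-antitone (rank ψ)) w∈)

    witness : ∀ {n} (ψ : Formula (graphSignature p) (suc n)) →
      RealisesTypes G ψ (C (suc (rank ψ))) (C (rank ψ)) → ∀ y →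
      Σ[ i ∈ Fin ∣ S ∣ ] enum S i Subset.∈ C (rank ψ) ×
        SameType ⟦ G ⟧ ψ (Subset._∈ C (suc (rank ψ))) y (enum S i)
    witness ψ real y with real y
    ... | r , r∈ , same =
      let r∈S = antitone z≤n r∈ ; e = sym (enum-index S r∈S) in
      index S r∈S , subst (Subset._∈ C (rank ψ)) e r∈ ,
      subst (SameType ⟦ G ⟧ ψ (Subset._∈ C (suc (rank ψ))) y) e same

  ⊨-relativize falsum        h real w w∈ = ⇔.refl
  ⊨-relativize (equal x y)   h real w w∈
    rewrite lookup-map x (enum S) w | lookup-map y (enum S) w = mk⇔ (enum-injective S) (cong (enum S))
  ⊨-relativize (atom₁ u x)   h real w w∈
    rewrite lookup-map x (enum S) w | Vector.lookup-++ˡ (color (induced G S)) levels u = ⇔.refl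
  ⊨-relativize (atom₂ e x y) h real w w∈
    rewrite lookup-map x (enum S) w | lookup-map y (enum S) w = ⇔.refl
  ⊨-relativize (neg φ)       h real w w∈ =
    let e = ⊨-relativize φ h real w w∈ in mk⇔ (_∘ from e) (_∘ to e)
  ⊨-relativize (and φ ψ)     h real w w∈ =
    -- A conjunct of smaller rank has a smaller index in the chain, hence a larger set for its
    -- variables.
    let l = m≤m⊔n (rank φ) (rank ψ)
        r = m≤n⊔m (rank φ) (rank ψ)
        d = ⊨-relativize φ _ (λ j j< → proj₁ (real j (≤-trans j< l))) w (All-antitone l w∈)
        e = ⊨-relativize ψ _ (λ j j< → proj₂ (real j (≤-trans j< r))) w (All-antitone r w∈)
    in mk⇔ (λ (p , q) → to d p , to e q) (λ (p , q) → from d p , from e q)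
  ⊨-relativize (or φ ψ)      h real w w∈ =
    let l = m≤m⊔n (rank φ) (rank ψ)
        r = m≤n⊔m (rank φ) (rank ψ)
        d = ⊨-relativize φ _ (λ j j< → proj₁ (real j (≤-trans j< l))) w (All-antitone l w∈)
        e = ⊨-relativize ψ _ (λ j j< → proj₂ (real j (≤-trans j< r))) w (All-antitone r w∈)
    in mk⇔ [ inj₁ ∘ to d , inj₂ ∘ to e ]′ [ inj₁ ∘ from d , inj₂ ∘ from e ]′
  ⊨-relativize (exists ψ)    h real w w∈ = mk⇔
    -- Only this direction exchanges the witness: a vertex of the lift already is a vertex of `G`.
    (λ (y , p) → let i , i∈ , same = witness ψ (proj₁ (real (rank ψ) ≤-refl)) y in
      i , from (∈level h i) i∈ , to (body i i∈) (to (same _ w∈) p))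
    (λ (i , c , p) → enum S i , from (body i (to (∈level h i) c)) p)
    where body = ⊨-relativize-body ψ h (λ j j≤ → real j (s≤s j≤)) w w∈
  ⊨-relativize (all′ ψ)      h real w w∈ = mk⇔
    (λ p i → from (⊨-imp lem ⟦ Ĝ ⟧ (atom₁ (levelColour h) zero) (relativize ψ (<⇒≤ h)))
      λ c → to (body i (to (∈level h i) c)) (p (enum S i)))
    -- An arbitrary `y` is judged by a vertex of the same type in the range of the restricted
    -- quantifier.
    (λ p y → let i , i∈ , same = witness ψ (proj₁ (real (rank ψ) ≤-refl)) y in
      from (same _ w∈) (from (body i i∈)
        (to (⊨-imp lem ⟦ Ĝ ⟧ (atom₁ (levelColour h) zero) (relativize ψ (<⇒≤ h))) (p i) (from (∈level h i) i∈))))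
    where
    body = ⊨-relativize-body ψ h (λ j j≤ → real j (s≤s j≤)) w w∈
    levelColour : ∀ {j} → j < q → Fin (p + q)
    levelColour h = p ↑ʳ fromℕ< h

-- This is `f` applied `q ∸ j` times to `a`. Indices count down: the final set has index 0, and the
-- sequence is constantly `a` from index `q` on.
iteratedNext : ∀ {A : Set} → (A → A) → A → ℕ → ℕ → A
iteratedNext f a zero    j       = a
iteratedNext f a (suc q) zero    = f (iteratedNext f a q zero)
iteratedNext f a (suc q) (suc j) = iteratedNext f a q j

module _ {n} (f : Subset n → Subset n) (f-inflationary : ∀ A → A Subset.⊆ f A) (A : Subset n) where

  iteratedNext-antitone : ∀ q j → iteratedNext f A q (suc j) Subset.⊆ iteratedNext f A q j
  iteratedNext-antitone zero    j       h = h
  iteratedNext-antitone (suc q) zero    h = f-inflationary _ h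
  iteratedNext-antitone (suc q) (suc j) h = iteratedNext-antitone q j h

  ⊆-iteratedNext : ∀ q j → A Subset.⊆ iteratedNext f A q j
  ⊆-iteratedNext zero    j       h = h
  ⊆-iteratedNext (suc q) zero    h = f-inflationary _ (⊆-iteratedNext q zero h)
  ⊆-iteratedNext (suc q) (suc j) h = ⊆-iteratedNext q j h

-- Polynomial kernels

iterate : Polynomial → ℕ → Polynomial
iterate Q zero    = var
iterate Q (suc q) = substitute Q (iterate Q q)

module _ (lem : ∀ ℓ → ExcludedMiddle ℓ) {ℓ p} {𝒞 : GraphClass p ℓ} (nip : MonadicallyNIP 𝒞) where

  HasRealisers : ∀ {n} → Formula (graphSignature p) n → Set ℓ
  HasRealisers φ = Σ[ Q ∈ Polynomial ] ∀ G → 𝒞 G → (A : Subset (order G)) →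
    Σ[ D ∈ Subset (order G) ] A Subset.⊆ D × ∣ D ∣ ≤ eval Q ∣ A ∣ × Realises G φ A D

  private
    trivial : ∀ {n} (φ : Formula (graphSignature p) n) → (∀ G A → Realises G φ A A) → HasRealisers φ
    trivial φ r = var , λ G _ A → A , id , ≤-refl , r G A

    union : ∀ {k m n} (φ : Formula (graphSignature p) k) (ψ : Formula (graphSignature p) m)
            (χ : Formula (graphSignature p) n) →
            (∀ {G C D} → Realises G φ C D × Realises G ψ C D → Realises G χ C D) →
            HasRealisers φ → HasRealisers ψ → HasRealisers χ
    union φ ψ χ both (Q , f) (R , g) = Q ⊕ R , λ G G∈ A →
      let D , A⊆D , #D , r = f G G∈ A
          E , A⊆E , #E , s = g G G∈ A
      in D ∪ E , (λ a∈ → p⊆p∪q E (A⊆D a∈))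
       , ≤-trans (∣p∪q∣≤∣p∣+∣q∣ D E) (+-mono-≤ #D #E)
       , both (realises-mono G φ (p⊆p∪q E) r , realises-mono G ψ (q⊆p∪q D E) s)

    -- One vertex for each type of `ψ` over `A` is added to a set that works for the body.
    quantifier : ∀ {n} (ψ : Formula (graphSignature p) (suc n)) (χ : Formula (graphSignature p) n) →
                 (∀ {G C D} → RealisesTypes G ψ C D × Realises G ψ C D → Realises G χ C D) →
                 HasRealisers ψ → HasRealisers χ
    -- Type bounds are stated for graphs with extra colours; here there are none.
    quantifier ψ χ both (Q , f) with types-bounded lem nip _ {0} (relabel inj₁ id id ψ)
    ... | R , g = Q ⊕ R , λ G G∈ A →
      let D , A⊆D , #D , r = f G G∈ A
          L , #L , cov = g G G∈ (λ ()) A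
          spec = λ y xs → ⊨-relabel inj₁ id {B = coloured G (λ ())} (≅-refl {A = ⟦ G ⟧}) id ψ {y ∷ xs} {y ∷ xs} (λ _ → refl)
      in D ∪ fromList L , (λ a∈ → p⊆p∪q (fromList L) (A⊆D a∈))
       , ≤-trans (∣p∪q∣≤∣p∣+∣q∣ D (fromList L)) (+-mono-≤ #D (≤-trans (∣fromList∣≤length L) #L))
       , both ( (λ y → let r , r∈ , same = find (cov y) in
                  r , q⊆p∪q D (fromList L) (∈-fromList r∈)
                    , λ xs xs∈ → ⇔.trans (⇔.sym (spec y xs)) (⇔.trans (same xs xs∈) (spec r xs)))
              , realises-mono G ψ (p⊆p∪q (fromList L)) r)

  hasRealisers : ∀ {n} (φ : Formula (graphSignature p) n) → HasRealisers φ
  hasRealisers φ@falsum        = trivial φ λ _ _ → tt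
  hasRealisers φ@(equal x y)   = trivial φ λ _ _ → tt
  hasRealisers φ@(atom₁ u x)   = trivial φ λ _ _ → tt
  hasRealisers φ@(atom₂ e x y) = trivial φ λ _ _ → tt
  hasRealisers (neg φ)         = hasRealisers φ
  hasRealisers χ@(and φ ψ)     = union φ ψ χ id (hasRealisers φ) (hasRealisers ψ)
  hasRealisers χ@(or φ ψ)      = union φ ψ χ id (hasRealisers φ) (hasRealisers ψ)
  hasRealisers χ@(exists ψ)    = quantifier ψ χ id (hasRealisers ψ)
  hasRealisers χ@(all′ ψ)      = quantifier ψ χ id (hasRealisers ψ)

  -- The chain has `rank φ` steps and starts from `B`, where the free variables take their values.
  -- Each step composes the size bound with `Q`; it stays polynomial since the number of steps
  -- depends on `φ` alone.
  kernel : ∀ {n} (φ : Formula (graphSignature p) n) →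
    Σ[ q ∈ ℕ ] Σ[ φ̂ ∈ Formula (graphSignature (p + q)) n ] Σ[ Q ∈ Polynomial ]
      ∀ G → 𝒞 G → (B : Subset (order G)) →
        Σ[ S ∈ Subset (order G) ] Σ[ new ∈ Vector (Vertex (induced G S) → Bool) q ]
          ∣ S ∣ ≤ eval Q ∣ B ∣ × B Subset.⊆ S ×
          (∀ w → All (Subset._∈ B) (map (enum S) w) →
            solutions φ G (map (enum S) w) ⇔ solutions φ̂ (monadicLift (induced G S) new) w)
  kernel φ with hasRealisers φ
  ... | Q , realisers = rank φ , relativize φ ≤-refl , iterate Q (rank φ) , λ G G∈ B →
    let module K = Chain G G∈ B in
    K.C (rank φ) 0 , levels (lem 0ℓ) G (K.C (rank φ)) (K.antitone (rank φ)) (rank φ)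
    , K.size (rank φ) , ⊆-iteratedNext K.next K.inflationary B (rank φ) 0
    , λ w w∈ → ⊨-relativize (lem 0ℓ) G (K.C (rank φ)) (K.antitone (rank φ)) (rank φ) φ ≤-refl
        (K.realises (rank φ)) w (All.map (⊆-iteratedNext K.next K.inflationary B (rank φ) (rank φ)) w∈)
    where
    module Chain (G : Graph p) (G∈ : 𝒞 G) (B : Subset (order G)) where
      next : Subset (order G) → Subset (order G)
      next A = proj₁ (realisers G G∈ A)

      inflationary : ∀ A → A Subset.⊆ next A
      inflationary A = proj₁ (proj₂ (realisers G G∈ A))

      C : ℕ → ℕ → Subset (order G)
      C = iteratedNext next B

      antitone : ∀ q j → C q (suc j) Subset.⊆ C q j
      antitone = iteratedNext-antitone next inflationary B

      size : ∀ q → ∣ C q 0 ∣ ≤ eval (iterate Q q) ∣ B ∣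
      size zero    = ≤-refl
      size (suc q) rewrite eval-substitute Q (iterate Q q) ∣ B ∣ =
        ≤-trans (proj₁ (proj₂ (proj₂ (realisers G G∈ (C q 0))))) (eval-mono Q (size q))

      realises : ∀ q j → j < q → Realises G φ (C q (suc j)) (C q j)
      realises (suc q) zero    _         = proj₂ (proj₂ (proj₂ (realisers G G∈ (C q 0))))
      realises (suc q) (suc j) (s≤s j<q) = realises q j j<q

-- `A` and `B` are kept apart for the sake of sentences, whose kernel is built over the empty set
-- while `A` is arbitrary.
restrict-≐ : ∀ {p q n} (φ : Formula (graphSignature p) n) (φ̂ : Formula (graphSignature (p + q)) n)
  (G : Graph p) (A B S : Subset (order G)) (new : Vector (Vertex (induced G S) → Bool) q) →
  B Subset.⊆ S → (∀ {v : Vec (Vertex G) n} → All (Subset._∈ A) v → All (Subset._∈ B) v) →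
  (∀ w → All (Subset._∈ B) (map (enum S) w) →
    solutions φ G (map (enum S) w) ⇔ solutions φ̂ (monadicLift (induced G S) new) w) →
  (solutions φ G ↾ A) ≐ (image S (solutions φ̂ (monadicLift (induced G S) new)) ↾ A)
restrict-≐ φ φ̂ G A B S new B⊆S A⇒B φ⇔φ̂ = forth , back
  where
  forth : ∀ {v} → (solutions φ G ↾ A) v → (image S (solutions φ̂ (monadicLift (induced G S) new)) ↾ A) v
  forth (φv , v∈) with enum-indices S (All.map B⊆S (A⇒B v∈))
  ... | w , refl = (w , refl , to (φ⇔φ̂ w (A⇒B v∈)) φv) , v∈

  back : ∀ {v} → (image S (solutions φ̂ (monadicLift (induced G S) new)) ↾ A) v → (solutions φ G ↾ A) v
  back ((w , refl , φ̂w) , v∈) = from (φ⇔φ̂ w (A⇒B v∈)) φ̂w , v∈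

theorem40 : (∀ ℓ → ExcludedMiddle ℓ) →
    ∀ {ℓ p n} (𝒞 : GraphClass p ℓ) → MonadicallyNIP 𝒞 →
    (φ : Formula (graphSignature p) n) →
    Σ[ q ∈ ℕ ] Σ[ φ̂ ∈ Formula (graphSignature (p + q)) n ] Σ[ c ∈ ℕ ] Σ[ k ∈ ℕ ]
    ((G : Graph p) → 𝒞 G → (A : Subset (order G)) →
    Σ[ S ∈ Subset (order G) ]
    Σ[ new ∈ Vector (Vertex (induced G S) → Bool) q ]
    let Ĝ = monadicLift (induced G S) new in
    order Ĝ ≤ c * ∣ A ∣ ^ k ×
    (solutions φ G ↾ A) ≐ (image S (solutions φ̂ Ĝ) ↾ A))
-- A sentence has to be evaluated even over A = ∅, where c * ∣ A ∣ ^ k vanishes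
-- unless k = 0; its kernel is therefore always built over the empty set.
theorem40 lem {n = zero} 𝒞 nip φ with kernel lem nip φ
... | q , φ̂ , Q , build = q , φ̂ , eval Q 0 , 0 , λ G G∈ A →
  let S , new , #S , _ , φ⇔φ̂ = build G G∈ Subset.⊥ in
  S , new
  , ≤-trans #S (≤-reflexive (trans (cong (eval Q) (∣⊥∣≡0 (order G))) (sym (*-identityʳ (eval Q 0)))))
  , restrict-≐ φ φ̂ G A Subset.⊥ S new (⊥-elim ∘ ∉⊥) (λ { [] → [] }) φ⇔φ̂
theorem40 lem {n = suc n} 𝒞 nip φ with kernel lem nip φ
... | q , φ̂ , Q , build with eval-monomial Q
...   | c , k , Q≤ = q , φ̂ , c , k , λ G G∈ A → bounded G G∈ A ∣ A ∣ refl
  where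
  bounded : ∀ G → 𝒞 G → (A : Subset (order G)) → ∀ a → ∣ A ∣ ≡ a →
    Σ[ S ∈ Subset (order G) ] Σ[ new ∈ Vector (Vertex (induced G S) → Bool) q ]
      ∣ S ∣ ≤ c * ∣ A ∣ ^ k ×
      (solutions φ G ↾ A) ≐ (image S (solutions φ̂ (monadicLift (induced G S) new)) ↾ A)
  -- Here the monomial may vanish while `Q` at 0 does not. But a nonempty tuple cannot lie in an
  -- empty set, so both sides are empty and `A` itself serves as `S`.
  bounded G G∈ A zero #A =
    A , (λ _ _ → false) , subst (_≤ c * ∣ A ∣ ^ k) (sym #A) z≤n
    , (λ { (_ , v∈ ∷ _) → empty v∈ }) , (λ { (_ , v∈ ∷ _) → empty v∈ })
    where
    empty : ∀ {v} {W : Set} → v Subset.∈ A → W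
    empty v∈ with subst Fin #A (index A v∈)
    ... | ()
  bounded G G∈ A (suc a) #A =
    let S , new , #S , A⊆S , φ⇔φ̂ = build G G∈ A in
    S , new , ≤-trans #S (Q≤ ∣ A ∣ (subst (1 ≤_) (sym #A) (s≤s z≤n)))
    , restrict-≐ φ φ̂ G A A S new A⊆S id φ⇔φ̂
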